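{- Let $k\geq 5$ be an integer and let $G$ be a finite connected graph of order at least $k$. Then $$\operatorname{sdiam}_k(G)\leq \frac{k+3}{k+1}\,\operatorname{srad}_k(G).$$
   Context: Graphs are finite, simple and undirected. The order of a graph is its number of vertices, and its size is its number of edges. For a connected graph $G$ and a non-empty set $S\subseteq V(G)$, the Steiner distance $d(S)$ is the minimum size (number of edges) of a connected subgraph of $G$ containing all vertices of $S$. For an integer $k$ with $2\le k\le |V(G)|$ and $v\in V(G)$, the Steiner $k$-eccentricity of $v$ is $\operatorname{e}_k(v)=\max\{d(S): S\subseteq V(G),\ |S|=k,\ v\in S\}$. The Steiner $k$-radius is $\operatorname{srad}_k(G)=\min\{\operatorname{e}_k(v):v\in V(G)\}$ and the Steiner $k$-diameter is $\operatorname{sdiam}_k(G)=\max\{\operatorname{e}_k(v):v\in V(G)\}$. -}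

module Defs where

open import Data.Bool using (Bool; T; T?)
open import Data.Fin as Fin using (Fin; zero; suc; toℕ; fromℕ<)
open import Data.Fin.Properties as Fin using (all?; any?; toℕ-injective; toℕ<n)
open import Data.Fin.Subset using (Subset; inside; outside; ⊤; ⊥; _∈_; _⊆_; ∣_∣)
open import Data.Fin.Subset.Properties
  using (anySubset?; _∈?_; _⊆?_; ∈⊤; ⊆⊤; ∣⊤∣≡n; ∣⊥∣≡0)
open import Data.List using (List; filter; length; cartesianProduct; allFin)
open import Data.List.Properties using (filter-≐)
open import Data.Nat using (ℕ; zero; suc; _≤_; _<_; z≤n; s≤s; _≟_)
open import Data.Nat.Properties
  using (≤-refl; ≤-reflexive; ≤-trans; ≮⇒≥; m≤n⇒m<n∨m≡n)
open import Data.Product using (Σ; ∃; _×_; _,_; proj₁; proj₂)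
open import Data.Sum using (_⊎_; inj₁; inj₂)
open import Data.Vec using (Vec; []; _∷_; lookup; tabulate; here; there)
open import Data.Vec.Properties using (lookup∘tabulate)
open import Function using (_∘_; id; case_of_)
open import Level using (Level; 0ℓ)
open import Relation.Binary.Core using (Rel)
open import Relation.Binary.Construct.Closure.ReflexiveTransitive as Star
  using (Star; ε; _◅_; _◅◅_)
open import Relation.Binary.Definitions
  using (Symmetric; Irreflexive) renaming (Decidable to Decidable₂)
open import Relation.Binary.PropositionalEquality
  using (_≡_; refl; sym; trans; cong; subst)
open import Relation.Nullary using (Dec; yes; no; ¬_; contradiction)
open import Relation.Nullary.Decidable using (map′; ¬?; _×-dec_; _⊎-dec_; _→-dec_)
open import Relation.Unary using (Pred; Decidable)

private variable
  ℓ : Level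
  n : ℕ

IsLeast : Pred ℕ ℓ → Pred ℕ ℓ
IsLeast P m = P m × (∀ {x} → P x → m ≤ x)

IsGreatest : Pred ℕ ℓ → Pred ℕ ℓ
IsGreatest P m = P m × (∀ {x} → P x → x ≤ m)

least : {P : Pred ℕ ℓ} → Decidable P → ∃ P → ∃ (IsLeast P)
least {P = P} P? (b , pb) with search (suc b)
  where
  search : ∀ b → ∃ (IsLeast P) ⊎ (∀ {x} → x < b → ¬ P x)
  search zero = inj₂ λ ()
  search (suc b) with search b
  ... | inj₁ l = inj₁ l
  ... | inj₂ none with P? b
  ...   | yes pb = inj₁ (b , pb , λ px → ≮⇒≥ λ x<b → none x<b px)
  ...   | no ¬pb = inj₂ λ { (s≤s x≤b) px → case m≤n⇒m<n∨m≡n x≤b of λ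
                      { (inj₁ x<b) → none x<b px ; (inj₂ refl) → ¬pb px } }
... | inj₁ l = l
... | inj₂ none = contradiction pb (none ≤-refl)

greatest : {P : Pred ℕ ℓ} → Decidable P → ∀ b → (∀ {x} → P x → x ≤ b) →
           ∃ P → ∃ (IsGreatest P)
greatest P? zero    bound (m , pm) =
  m , pm , λ px → ≤-trans (bound px) z≤n
greatest P? (suc b) bound inhabited with P? (suc b)
... | yes p = suc b , p , bound
... | no ¬p = greatest P? b bound′ inhabited
  where
  bound′ : ∀ {x} → _ → x ≤ b
  bound′ px with m≤n⇒m<n∨m≡n (bound px)
  ... | inj₁ (s≤s x≤b) = x≤b
  ... | inj₂ refl = contradiction px ¬p

anyVec? : {A : Set} → (∀ {P : Pred A 0ℓ} → Decidable P → Dec (∃ P)) →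
          ∀ m {P : Pred (Vec A m) 0ℓ} → Decidable P → Dec (∃ P)
anyVec? any zero    P? = map′ ([] ,_) (λ { ([] , p) → p }) (P? [])
anyVec? any (suc m) P? =
  map′ (λ { (x , xs , p) → x ∷ xs , p }) (λ { (x ∷ xs , p) → x , xs , p })
       (any λ x → anyVec? any m λ xs → P? (x ∷ xs))

-- Warshall's algorithm: Via m i j asserts a walk from i to j whose interior
-- vertices are all among the first m.
module _ {R : Rel (Fin n) 0ℓ} (R? : Decidable₂ R) where

  private
    Via : ℕ → Rel (Fin n) 0ℓ
    Via zero    i j = i ≡ j ⊎ R i j
    Via (suc m) i j = Via m i j ⊎ ∃ λ v → toℕ v ≡ m × Via m i v × Via m v j

    via? : ∀ m → Decidable₂ (Via m)
    via? zero    i j = (i Fin.≟ j) ⊎-dec R? i j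
    via? (suc m) i j =
      via? m i j ⊎-dec any? λ v → (toℕ v ≟ m) ×-dec via? m i v ×-dec via? m v j

    through : ∀ m {i v j} → toℕ v < m → Via m i v → Via m v j → Via m i j
    through (suc m) {i} {v} {j} (s≤s v≤m) p q with m≤n⇒m<n∨m≡n v≤m
    ... | inj₂ v≡m = inj₂ (v , v≡m , left p , right q)
      where
      left : Via (suc m) i v → Via m i v
      left (inj₁ p) = p
      left (inj₂ (w , w≡m , p , _)) with toℕ-injective (trans w≡m (sym v≡m))
      ... | refl = p
      right : Via (suc m) v j → Via m v j
      right (inj₁ q) = q
      right (inj₂ (w , w≡m , _ , q)) with toℕ-injective (trans w≡m (sym v≡m))
      ... | refl = q
    ... | inj₁ v<m = join p q
      where
      join : Via (suc m) i v → Via (suc m) v j → Via (suc m) i j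
      join (inj₁ p) (inj₁ q) = inj₁ (through m v<m p q)
      join (inj₁ p) (inj₂ (w , w≡m , q , q′)) = inj₂ (w , w≡m , through m v<m p q , q′)
      join (inj₂ (w , w≡m , p , p′)) (inj₁ q) = inj₂ (w , w≡m , p , through m v<m p′ q)
      join (inj₂ (w , w≡m , p , _)) (inj₂ (w′ , w′≡m , _ , q))
        with toℕ-injective (trans w≡m (sym w′≡m))
      ... | refl = inj₂ (w , w≡m , p , q)

    via⇒star : ∀ m {i j} → Via m i j → Star R i j
    via⇒star zero    (inj₁ refl) = ε
    via⇒star zero    (inj₂ r) = r ◅ ε
    via⇒star (suc m) (inj₁ p) = via⇒star m p
    via⇒star (suc m) (inj₂ (_ , _ , p , q)) = via⇒star m p ◅◅ via⇒star m q

    base : ∀ m {i j} → Via zero i j → Via m i j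
    base zero    p = p
    base (suc m) p = inj₁ (base m p)

    star⇒via : ∀ {i j} → Star R i j → Via n i j
    star⇒via ε = base n (inj₁ refl)
    star⇒via (_◅_ {j = v} r rs) =
      through n (toℕ<n v) (base n (inj₂ r)) (star⇒via rs)

  star? : Decidable₂ (Star R)
  star? i j = map′ (via⇒star n) star⇒via (via? n i j)

Edge : (Fin n → Fin n → Bool) → Pred (Fin n × Fin n) 0ℓ
Edge adj (i , j) = i Fin.< j × T (adj i j)

edge? : (adj : Fin n → Fin n → Bool) → Decidable (Edge adj)
edge? adj (i , j) = (i Fin.<? j) ×-dec T? (adj i j)

edges : (Fin n → Fin n → Bool) → List (Fin n × Fin n)
edges {n} adj = filter (edge? adj) (cartesianProduct (allFin n) (allFin n))

record Graph (n : ℕ) : Set where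
  field
    adjacent : Fin n → Fin n → Bool

  infix 4 _~_
  _~_ : Rel (Fin n) 0ℓ
  i ~ j = T (adjacent i j)

  field
    symmetric   : Symmetric _~_
    irreflexive : Irreflexive _≡_ _~_

  size : ℕ
  size = length (edges adjacent)

  Connected : Set
  Connected = ∀ i j → Star _~_ i j

open Graph using (size; Connected) public

-- The edges of a subgraph are carried by a graph on the ambient vertex set in
-- which every vertex outside the subgraph is isolated.
record Subgraph (G : Graph n) : Set where
  field
    vertices : Subset n
    graph    : Graph n

  open Graph graph public using (_~_)

  field
    edge⇒edge   : ∀ {i j} → i ~ j → Graph._~_ G i j
    edge⇒vertex : ∀ {i j} → i ~ j → i ∈ vertices

  ConnectedSubgraph : Set
  ConnectedSubgraph = ∀ {i j} → i ∈ vertices → j ∈ vertices → Star _~_ i j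

open Subgraph using (vertices; graph; ConnectedSubgraph) public

ConnectingSize : Graph n → Subset n → Pred ℕ 0ℓ
ConnectingSize G S m =
  Σ (Subgraph G) λ H → ConnectedSubgraph H × S ⊆ vertices H × size (graph H) ≡ m

private
  module _ (G : Graph n) (S : Subset n) (m : ℕ) where

    Good : Subset n → (Fin n → Fin n → Bool) → Set
    Good V adj =
      (∀ i j → T (adj i j) → T (adj j i)) ×
      (∀ i → ¬ T (adj i i)) ×
      (∀ i j → T (adj i j) → Graph._~_ G i j) ×
      (∀ i j → T (adj i j) → i ∈ V) ×
      (∀ i j → i ∈ V → j ∈ V → Star (λ x y → T (adj x y)) i j) ×
      S ⊆ V ×
      length (edges adj) ≡ m

    good? : ∀ V adj → Dec (Good V adj)
    good? V adj =
      (all? λ i → all? λ j → T? _ →-dec T? _) ×-dec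
      (all? λ i → ¬? (T? _)) ×-dec
      (all? λ i → all? λ j → T? _ →-dec T? _) ×-dec
      (all? λ i → all? λ j → T? _ →-dec (i ∈? V)) ×-dec
      (all? λ i → all? λ j →
        (i ∈? V) →-dec (j ∈? V) →-dec star? (λ x y → T? (adj x y)) i j) ×-dec
      (S ⊆? V) ×-dec
      (length (edges adj) ≟ m)

    good-resp : ∀ {V adj adj′} → (∀ i j → adj i j ≡ adj′ i j) →
                Good V adj → Good V adj′
    good-resp {adj = adj} {adj′} eq (s , r , e , v , c , S⊆V , l) =
      (λ i j → to ∘ s i j ∘ from) , (λ i → r i ∘ from) , (λ i j → e i j ∘ from) ,
      (λ i j → v i j ∘ from) , (λ i j p q → Star.map to (c i j p q)) , S⊆V ,
      trans (cong length (sym (filter-≐ (edge? adj) (edge? adj′)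
        ((λ (p , q) → p , to q) , (λ (p , q) → p , from q))
        (cartesianProduct (allFin n) (allFin n))))) l
      where
      to : ∀ {i j} → T (adj i j) → T (adj′ i j)
      to {i} {j} = subst T (eq i j)
      from : ∀ {i j} → T (adj′ i j) → T (adj i j)
      from {i} {j} = subst T (sym (eq i j))

    fromMatrix : Vec (Subset n) n → Fin n → Fin n → Bool
    fromMatrix M i j = lookup (lookup M i) j

    toMatrix : (Fin n → Fin n → Bool) → Vec (Subset n) n
    toMatrix adj = tabulate (tabulate ∘ adj)

    from∘to : ∀ adj i j → adj i j ≡ fromMatrix (toMatrix adj) i j
    from∘to adj i j = sym (trans
      (cong (λ v → lookup v j) (lookup∘tabulate (tabulate ∘ adj) i))
      (lookup∘tabulate (adj i) j))

    good⇒ : ∀ {V adj} → Good V adj → ConnectingSize G S m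
    good⇒ {V} {adj} (s , r , e , v , c , S⊆V , l) =
      record
        { vertices = V
        ; graph = record { adjacent = adj
                         ; symmetric = s _ _
                         ; irreflexive = λ { refl → r _ } }
        ; edge⇒edge = e _ _
        ; edge⇒vertex = v _ _ } ,
      c _ _ , S⊆V , l

    ⇒good : ((H , _) : ConnectingSize G S m) →
            Good (vertices H) (Graph.adjacent (graph H))
    ⇒good (H , c , S⊆V , l) =
      (λ _ _ → Graph.symmetric (graph H)) ,
      (λ _ → Graph.irreflexive (graph H) refl) ,
      (λ _ _ → Subgraph.edge⇒edge H) , (λ _ _ → Subgraph.edge⇒vertex H) ,
      (λ _ _ → c) , S⊆V , l

connectingSize? : ∀ (G : Graph n) S → Decidable (ConnectingSize G S)
connectingSize? {n} G S m = map′
  (λ (_ , _ , g) → good⇒ G S m g)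
  (λ x@(H , _) → let adj = Graph.adjacent (graph H) in
    vertices H , toMatrix G S m adj ,
    good-resp G S m (from∘to G S m adj) (⇒good G S m x))
  (anySubset? λ V → anyVec? anySubset? n λ M → good? G S m V (fromMatrix G S m M))

whole : (G : Graph n) → Connected G → ∀ S → ConnectingSize G S (size G)
whole G conn S =
  record { vertices = ⊤ ; graph = G ; edge⇒edge = id ; edge⇒vertex = λ _ → ∈⊤ } ,
  (λ _ _ → conn _ _) , ⊆⊤ , refl

subsetOfSize : ∀ {k} → k ≤ n → ∃ λ (S : Subset n) → ∣ S ∣ ≡ k
subsetOfSize {n} z≤n = ⊥ , ∣⊥∣≡0 n
subsetOfSize (s≤s k≤n) with subsetOfSize k≤n
... | S , eq = inside ∷ S , cong suc eq

subsetOfSize∋ : ∀ {k} → 1 ≤ k → k ≤ n → (v : Fin n) →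
                ∃ λ (S : Subset n) → ∣ S ∣ ≡ k × v ∈ S
subsetOfSize∋ _ (s≤s k≤n) zero with subsetOfSize k≤n
... | S , eq = inside ∷ S , cong suc eq , here
subsetOfSize∋ {n} 1≤k k≤n (suc v) with m≤n⇒m<n∨m≡n k≤n
... | inj₂ refl = ⊤ , ∣⊤∣≡n n , ∈⊤
... | inj₁ (s≤s k≤n-1) with subsetOfSize∋ 1≤k k≤n-1 v
...   | S , eq , v∈S = outside ∷ S , eq , there v∈S

module _ (G : Graph n) (conn : Connected G) where

  private
    leastSize : ∀ S → ∃ (IsLeast (ConnectingSize G S))
    leastSize S = least (connectingSize? G S) (size G , whole G conn S)

  -- Only meaningful for non-empty S; it is 0 at the empty set.
  steinerDistance : Subset n → ℕ
  steinerDistance S = proj₁ (leastSize S)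

  steinerDistance-isLeast : ∀ S → IsLeast (ConnectingSize G S) (steinerDistance S)
  steinerDistance-isLeast S = proj₂ (leastSize S)

  steinerDistance≤size : ∀ S → steinerDistance S ≤ size G
  steinerDistance≤size S = proj₂ (steinerDistance-isLeast S) (whole G conn S)

  DistanceAt : ℕ → Fin n → Pred ℕ 0ℓ
  DistanceAt k v m = ∃ λ S → ∣ S ∣ ≡ k × v ∈ S × steinerDistance S ≡ m

  module _ (k : ℕ) (2≤k : 2 ≤ k) (k≤n : k ≤ n) where

    private
      maxDistance : ∀ v → ∃ (IsGreatest (DistanceAt k v))
      maxDistance v = greatest
        (λ m → anySubset? λ S →
          (∣ S ∣ ≟ k) ×-dec (v ∈? S) ×-dec (steinerDistance S ≟ m))
        (size G)
        (λ { (S , _ , _ , refl) → steinerDistance≤size S })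
        (let S , eq , v∈S = subsetOfSize∋ (≤-trans (s≤s z≤n) 2≤k) k≤n v
         in steinerDistance S , S , eq , v∈S , refl)

    eccentricity : Fin n → ℕ
    eccentricity v = proj₁ (maxDistance v)

    eccentricity-isGreatest : ∀ v → IsGreatest (DistanceAt k v) (eccentricity v)
    eccentricity-isGreatest v = proj₂ (maxDistance v)

    Eccentricity : Pred ℕ 0ℓ
    Eccentricity m = ∃ λ v → eccentricity v ≡ m

    private
      eccentricity? : Decidable Eccentricity
      eccentricity? m = any? λ v → eccentricity v ≟ m

      eccentricity≤size : ∀ {m} → Eccentricity m → m ≤ size G
      eccentricity≤size (v , refl) with proj₁ (eccentricity-isGreatest v)
      ... | S , _ , _ , eq = ≤-trans (≤-reflexive (sym eq)) (steinerDistance≤size S)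

      someEccentricity : ∃ Eccentricity
      someEccentricity =
        _ , fromℕ< (≤-trans (s≤s z≤n) (≤-trans 2≤k k≤n)) , refl

      minEccentricity : ∃ (IsLeast Eccentricity)
      minEccentricity = least eccentricity? someEccentricity

      maxEccentricity : ∃ (IsGreatest Eccentricity)
      maxEccentricity =
        greatest eccentricity? (size G) eccentricity≤size someEccentricity

    srad : ℕ
    srad = proj₁ minEccentricity

    srad-isLeast : IsLeast Eccentricity srad
    srad-isLeast = proj₂ minEccentricity

    sdiam : ℕ
    sdiam = proj₁ maxEccentricity

    sdiam-isGreatest : IsGreatest Eccentricity sdiam
    sdiam-isGreatest = proj₂ maxEccentricity

{-# OPTIONS --safe #-}

-- Let R be the k-radius, v a vertex of k-eccentricity R, and S a k-set of
-- Steiner distance R + x with x > 0, so that v ∉ S.  A Steiner tree of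
-- (S - s) ∪ {v} has at most R edges, and attaching s to it by a walk gives a
-- connected subgraph containing S; hence every walk from v to S, and every
-- walk between distinct vertices of S, has length at least x.
-- Let s and y be the closest pair of S, at distance a ≥ x, and let T be a
-- Steiner tree of (S - s) ∪ {v}, rooted at v.  Follow T from v along a stem of
-- p edges to the first vertex q where S - s is divided between two subtrees,
-- and let t be the number of edges beyond the stem, so p + t ≤ R.  Dropping
-- the stem and attaching s to y gives R + x ≤ t + a, hence p + x ≤ a.  Closed
-- traversals from q of the two parts have at least four pieces of length
-- ≥ x - p and k - 3 further gaps of length ≥ a, so
--   2R ≥ 2p + 2t ≥ 4x - 2p + (k - 3) a ≥ 6x + (k - 5) a ≥ (k + 1) x,
-- where the last step uses k ≥ 5.
module Submission where

open import Defs
open import Data.Bool using (Bool; T?)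
open import Data.Fin as Fin using (Fin; zero; suc)
open import Data.Fin.Properties as Fin using (any?; <-cmp; injective⇒≤)
open import Data.Fin.Subset
  using (Subset; inside; outside; _∈_; _∉_; _⊆_; ∣_∣; ⁅_⁆; ∁; _∩_; _∪_; _-_; Nonempty)
open import Data.Fin.Subset.Properties
  using (_∈?_; nonempty?; Empty-unique; ∣⊥∣≡0; x∈⁅x⁆; x∈⁅y⁆⇒x≡y; ∣⁅x⁆∣≡1; p⊆q⇒∣p∣≤∣q∣; p⊆p∪q; q⊆p∪q; x∈p∪q⁻;
         p∩q⊆p; p∩q⊆q; x∈p∩q⁺; x∈p∩q⁻; x∈∁p⇒x∉p; x∉p⇒x∈∁p; p─⊥≡p; p─q⊆p; ∪-identityʳ;
         x∈p∧x≢y⇒x∈p-y)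
open import Data.Integer as ℤ using (+_)
import Data.Integer.Properties as ℤ
open import Data.List as List using (List; []; _∷_; _++_; length; allFin; cartesianProduct)
import Data.List.Membership.DecPropositional as DecMembership
open import Data.List.Membership.Propositional using () renaming (_∈_ to _∈ˡ_; _∉_ to _∉ˡ_)
open import Data.List.Membership.Propositional.Properties
  using (∈-lookup; ∈-filter⁺; ∈-filter⁻; ∈-cartesianProduct⁺; ∈-allFin; ∈-++⁺ˡ; ∈-++⁺ʳ; ∈-++⁻)
open import Data.List.Properties using (length-++)
import Data.List.Relation.Unary.All as All
open import Data.List.Relation.Unary.All.Properties using (¬Any⇒All¬)
open import Data.List.Relation.Unary.AllPairs using ([]; _∷_)
open import Data.List.Relation.Unary.Any using (here; there; index)
open import Data.List.Relation.Unary.Any.Properties using (lookup-index)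
open import Data.List.Relation.Unary.Unique.Propositional using (Unique)
open import Data.List.Relation.Unary.Unique.Propositional.Properties
  using (allFin⁺; cartesianProduct⁺; filter⁺)
open import Data.Nat as Nat using (ℕ; zero; suc; _≤_; _<_; _+_; z≤n; s≤s; s≤s⁻¹)
open import Data.Nat.Properties hiding (<-cmp; _≟_)
open import Data.Product using (∃; ∃₂; _×_; _,_; proj₁; proj₂; -,_)
open import Data.Product.Properties using (≡-dec)
import Data.Rational.Properties as ℚ
import Data.Rational.Unnormalised as ℚᵘ
import Data.Rational.Unnormalised.Properties as ℚᵘ
open import Data.Sum using (_⊎_; inj₁; inj₂; [_,_]′)
open import Data.Nat.Tactic.RingSolver using (solve-∀)
open import Data.Vec using ([]; _∷_; here; there)
open import Function using (_∘_; id)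
open import Relation.Binary.Construct.Closure.ReflexiveTransitive as Star using (Star; ε; _◅_; _◅◅_)
open import Relation.Binary.Definitions using (tri<; tri≈; tri>)
open import Relation.Binary.PropositionalEquality
open import Relation.Nullary using (Dec; yes; no; contradiction)
open import Relation.Nullary.Decidable using (_×-dec_; ¬?; isYes; toWitness; fromWitness)

private variable
  n : ℕ

-- Cardinalities of subsets and of duplicate-free lists.

∣p∩q∣+∣p∩∁q∣≡∣p∣ : (p q : Subset n) → ∣ p ∩ q ∣ + ∣ p ∩ ∁ q ∣ ≡ ∣ p ∣
∣p∩q∣+∣p∩∁q∣≡∣p∣ []            []            = refl
∣p∩q∣+∣p∩∁q∣≡∣p∣ (outside ∷ p) (_ ∷ q)       = ∣p∩q∣+∣p∩∁q∣≡∣p∣ p q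
∣p∩q∣+∣p∩∁q∣≡∣p∣ (inside ∷ p)  (inside ∷ q)  = cong suc (∣p∩q∣+∣p∩∁q∣≡∣p∣ p q)
∣p∩q∣+∣p∩∁q∣≡∣p∣ (inside ∷ p)  (outside ∷ q) =
  trans (+-suc _ _) (cong suc (∣p∩q∣+∣p∩∁q∣≡∣p∣ p q))

x∈p⇒suc∣p-x∣≡∣p∣ : {p : Subset n} {x : Fin n} → x ∈ p → suc ∣ p - x ∣ ≡ ∣ p ∣
x∈p⇒suc∣p-x∣≡∣p∣ {p = _ ∷ p} here = cong (suc ∘ ∣_∣) (p─⊥≡p p)
x∈p⇒suc∣p-x∣≡∣p∣ {p = outside ∷ p} (there x∈p) = x∈p⇒suc∣p-x∣≡∣p∣ x∈p
x∈p⇒suc∣p-x∣≡∣p∣ {p = inside ∷ p} (there x∈p) = cong suc (x∈p⇒suc∣p-x∣≡∣p∣ x∈p)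

x∉p⇒∣p∪⁅x⁆∣≡suc∣p∣ : (p : Subset n) {x : Fin n} → x ∉ p → ∣ p ∪ ⁅ x ⁆ ∣ ≡ suc ∣ p ∣
x∉p⇒∣p∪⁅x⁆∣≡suc∣p∣ (inside ∷ p)  {zero}  x∉p = contradiction here x∉p
x∉p⇒∣p∪⁅x⁆∣≡suc∣p∣ (outside ∷ p) {zero}  x∉p = cong (suc ∘ ∣_∣) (∪-identityʳ p)
x∉p⇒∣p∪⁅x⁆∣≡suc∣p∣ (inside ∷ p)  {suc x} x∉p = cong suc (x∉p⇒∣p∪⁅x⁆∣≡suc∣p∣ p (x∉p ∘ there))
x∉p⇒∣p∪⁅x⁆∣≡suc∣p∣ (outside ∷ p) {suc x} x∉p = x∉p⇒∣p∪⁅x⁆∣≡suc∣p∣ p (x∉p ∘ there)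

x∈p-y⇒x≢y : (p : Subset n) {x y : Fin n} → x ∈ p - y → x ≢ y
x∈p-y⇒x≢y (_ ∷ _) {zero}  ()         refl
x∈p-y⇒x≢y (_ ∷ p) {suc x} (there x∈) refl = x∈p-y⇒x≢y p x∈ refl

nonempty : {p : Subset n} → 1 ≤ ∣ p ∣ → Nonempty p
nonempty {n} {p} 1≤ with nonempty? p
... | yes ne = ne
... | no empty = contradiction (≤-trans 1≤ (≤-reflexive (trans (cong ∣_∣ (Empty-unique empty)) (∣⊥∣≡0 n)))) λ ()

unique-lookup-injective : {A : Set} {xs : List A} → Unique xs →
                          ∀ {i j} → List.lookup xs i ≡ List.lookup xs j → i ≡ j
unique-lookup-injective (_ ∷ _)  {zero}  {zero}  _  = refl
unique-lookup-injective {xs = _ ∷ xs} (x∉ ∷ _) {zero}  {suc j} eq =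
  contradiction eq (All.lookup x∉ (∈-lookup {xs = xs} j))
unique-lookup-injective {xs = _ ∷ xs} (x∉ ∷ _) {suc i} {zero}  eq =
  contradiction (sym eq) (All.lookup x∉ (∈-lookup {xs = xs} i))
unique-lookup-injective (_ ∷ u)  {suc i} {suc j} eq = cong suc (unique-lookup-injective u eq)

unique-⊆⇒length≤ : {A : Set} {xs ys : List A} → Unique xs →
                   (∀ {x} → x ∈ˡ xs → x ∈ˡ ys) → length xs ≤ length ys
unique-⊆⇒length≤ {xs = xs} {ys} u xs⊆ys = injective⇒≤ {f = λ i → index (pos i)} λ {i} {j} eq →
  unique-lookup-injective u (trans (lookup-index (pos i))
    (trans (cong (List.lookup ys) eq) (sym (lookup-index (pos j)))))
  where
  pos : ∀ i → List.lookup xs i ∈ˡ ys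
  pos i = xs⊆ys (∈-lookup {xs = xs} i)

-- Undirected edges as ordered pairs.

orient : Fin n → Fin n → Fin n × Fin n
orient i j with i Fin.<? j
... | yes _ = i , j
... | no  _ = j , i

orient-< : {i j : Fin n} → i Fin.< j → orient i j ≡ (i , j)
orient-< {i = i} {j} i<j with i Fin.<? j
... | yes _  = refl
... | no i≮j = contradiction i<j i≮j

orient-> : {i j : Fin n} → j Fin.< i → orient i j ≡ (j , i)
orient-> {i = i} {j} j<i with i Fin.<? j
... | yes i<j = contradiction j<i (<-asym i<j)
... | no _    = refl

orient-comm : (i j : Fin n) → orient i j ≡ orient j i
orient-comm i j with <-cmp i j
... | tri< i<j _ _ = trans (orient-< i<j) (sym (orient-> i<j))
... | tri≈ _ refl _ = refl
... | tri> _ _ j<i = trans (orient-> j<i) (sym (orient-< j<i))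

module _ {adj : Fin n → Fin n → Bool} where

  edges-unique : Unique (edges adj)
  edges-unique = filter⁺ (edge? adj) (cartesianProduct⁺ (allFin⁺ n) (allFin⁺ n))

  ∈-edges⁺ : ∀ {i j} → Edge adj (i , j) → (i , j) ∈ˡ edges adj
  ∈-edges⁺ = ∈-filter⁺ (edge? adj) (∈-cartesianProduct⁺ (∈-allFin _) (∈-allFin _))

  ∈-edges⁻ : ∀ {e} → e ∈ˡ edges adj → Edge adj e
  ∈-edges⁻ = proj₂ ∘ ∈-filter⁻ (edge? adj) {xs = cartesianProduct (allFin n) (allFin n)}

orient∈edges : (G : Graph n) → ∀ {i j} → Graph._~_ G i j → orient i j ∈ˡ edges (Graph.adjacent G)
orient∈edges G {i} {j} i~j with <-cmp i j
... | tri< i<j _ _ rewrite orient-< i<j = ∈-edges⁺ (i<j , i~j)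
... | tri≈ _ i≡j _ = contradiction i~j (Graph.irreflexive G i≡j)
... | tri> _ _ j<i rewrite orient-> j<i = ∈-edges⁺ (j<i , Graph.symmetric G i~j)

-- Walks and rooted trees in a graph.

module _ (G : Graph n) where

  open Graph G using (_~_; adjacent; symmetric; irreflexive)

  -- The length is an index, so that for each fixed length existence is decidable by finite search;
  -- minimising over lengths in `closestPair` relies on this.
  Walk : ℕ → Fin n → Fin n → Set
  Walk zero    x y = x ≡ y
  Walk (suc l) x y = ∃ λ w → x ~ w × Walk l w y

  walk? : ∀ l x y → Dec (Walk l x y)
  walk? zero    x y = x Fin.≟ y
  walk? (suc l) x y = any? λ w → T? (adjacent x w) ×-dec walk? l w y

  walk-++ : ∀ k {l x y z} → Walk k x y → Walk l y z → Walk (k + l) x z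
  walk-++ zero    refl          q = q
  walk-++ (suc k) (w , x~w , p) q = w , x~w , walk-++ k p q

  walk-reverse : ∀ l {x y} → Walk l x y → Walk l y x
  walk-reverse zero    refl = refl
  walk-reverse (suc l) {x} {y} (w , x~w , p) =
    subst (λ m → Walk m y x) (+-comm l 1)
      (walk-++ l (walk-reverse l p) (x , symmetric x~w , refl))

  star⇒walk : ∀ {x y} → Star _~_ x y → ∃ λ l → Walk l x y
  star⇒walk ε = 0 , refl
  star⇒walk (x~w ◅ s) = let l , p = star⇒walk s in suc l , -, x~w , p

  -- A formal tree mapped into the graph: vertices and edges may repeat, so its image can contain
  -- cycles. Accordingly `∥_∥` counts steps with multiplicity and only bounds the number of edges of
  -- the image from above.
  data Tree : Fin n → Set where
    leaf : ∀ r → Tree r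
    step : ∀ {r w} → r ~ w → Tree w → Tree r
    join : ∀ {r} → Tree r → Tree r → Tree r

  ∥_∥ : ∀ {r} → Tree r → ℕ
  ∥ leaf _ ∥   = 0
  ∥ step _ T ∥ = suc ∥ T ∥
  ∥ join T U ∥ = ∥ T ∥ + ∥ U ∥

  nodes : ∀ {r} → Tree r → Subset n
  nodes (leaf r)       = ⁅ r ⁆
  nodes (step {r} _ T) = ⁅ r ⁆ ∪ nodes T
  nodes (join T U)     = nodes T ∪ nodes U

  root∈nodes : ∀ {r} (T : Tree r) → r ∈ nodes T
  root∈nodes (leaf r)   = x∈⁅x⁆ r
  root∈nodes (step {r} _ T) = p⊆p∪q (nodes T) (x∈⁅x⁆ r)
  root∈nodes (join T U) = p⊆p∪q (nodes U) (root∈nodes T)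

  Extension : ∀ {r} → Tree r → Fin n → ℕ → Set
  Extension {r} T y l = ∃ λ (T′ : Tree r) → ∥ T′ ∥ ≡ l + ∥ T ∥ × nodes T ⊆ nodes T′ × y ∈ nodes T′

  extendAtRoot : ∀ {r y} (T : Tree r) → r ~ y → Extension T y 1
  extendAtRoot {r} {y} T r~y =
    join (step r~y (leaf y)) T , refl , q⊆p∪q _ (nodes T) ,
    p⊆p∪q (nodes T) (q⊆p∪q ⁅ r ⁆ ⁅ y ⁆ (x∈⁅x⁆ y))

  ∪-monoˡ : ∀ {p q} (s : Subset n) → p ⊆ q → p ∪ s ⊆ q ∪ s
  ∪-monoˡ {p} {q} s p⊆q x∈ with x∈p∪q⁻ p s x∈
  ... | inj₁ x∈p = p⊆p∪q s (p⊆q x∈p)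
  ... | inj₂ x∈s = q⊆p∪q q s x∈s

  ∪-monoʳ : ∀ {p q} (s : Subset n) → p ⊆ q → s ∪ p ⊆ s ∪ q
  ∪-monoʳ {p} {q} s p⊆q x∈ with x∈p∪q⁻ s p x∈
  ... | inj₁ x∈s = p⊆p∪q q x∈s
  ... | inj₂ x∈p = q⊆p∪q s q (p⊆q x∈p)

  extend : ∀ {r x y} (T : Tree r) → x ∈ nodes T → x ~ y → Extension T y 1
  extend (leaf r) x∈ x~y with refl ← x∈⁅y⁆⇒x≡y r x∈ = extendAtRoot (leaf r) x~y
  extend {r} T@(step r~w U) x∈ x~y with x∈p∪q⁻ ⁅ r ⁆ (nodes U) x∈
  ... | inj₁ x∈r with refl ← x∈⁅y⁆⇒x≡y r x∈r = extendAtRoot T x~y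
  ... | inj₂ x∈U = let U′ , size , U⊆U′ , y∈U′ = extend U x∈U x~y in
    step r~w U′ , cong suc size , ∪-monoʳ ⁅ r ⁆ U⊆U′ , q⊆p∪q ⁅ r ⁆ (nodes U′) y∈U′
  extend (join T U) x∈ x~y with x∈p∪q⁻ (nodes T) (nodes U) x∈
  ... | inj₁ x∈T = let T′ , size , T⊆T′ , y∈T′ = extend T x∈T x~y in
    join T′ U , cong (_+ ∥ U ∥) size , ∪-monoˡ (nodes U) T⊆T′ , p⊆p∪q (nodes U) y∈T′
  ... | inj₂ x∈U = let U′ , size , U⊆U′ , y∈U′ = extend U x∈U x~y in
    join T U′ , trans (cong (_+_ ∥ T ∥) size) (+-suc ∥ T ∥ ∥ U ∥) ,
    ∪-monoʳ (nodes T) U⊆U′ , q⊆p∪q (nodes T) (nodes U′) y∈U′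

  extendByWalk : ∀ l {r x y} (T : Tree r) → x ∈ nodes T → Walk l x y → Extension T y l
  extendByWalk zero    T x∈T refl = T , refl , id , x∈T
  extendByWalk (suc l) T x∈T (w , x~w , p) =
    let T₁ , size₁ , T⊆T₁ , w∈T₁ = extend T x∈T x~w
        T₂ , size₂ , T₁⊆T₂ , y∈T₂ = extendByWalk l T₁ w∈T₁ p
    in T₂ , trans size₂ (trans (cong (_+_ l) size₁) (+-suc l ∥ T ∥)) , T₁⊆T₂ ∘ T⊆T₁ , y∈T₂

  -- From rooted trees to connected subgraphs.

  segments : ∀ {r} → Tree r → List (Fin n × Fin n)
  segments (leaf _)           = []
  segments (step {r} {w} _ T) = orient r w ∷ segments T
  segments (join T U)         = segments T ++ segments U

  length-segments : ∀ {r} (T : Tree r) → length (segments T) ≡ ∥ T ∥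
  length-segments (leaf _)   = refl
  length-segments (step _ T) = cong suc (length-segments T)
  length-segments (join T U) =
    trans (length-++ (segments T)) (cong₂ _+_ (length-segments T) (length-segments U))

  segments⇒edge : ∀ {r} (T : Tree r) {i j} → (i , j) ∈ˡ segments T → i ~ j
  segments⇒edge (step {r} {w} r~w T) (here eq) with r Fin.<? w | eq
  ... | yes _ | refl = r~w
  ... | no  _ | refl = symmetric r~w
  segments⇒edge (step _ T) (there e∈) = segments⇒edge T e∈
  segments⇒edge (join T U) e∈ with ∈-++⁻ (segments T) e∈
  ... | inj₁ e∈T = segments⇒edge T e∈T
  ... | inj₂ e∈U = segments⇒edge U e∈U

  segments⊆nodes : ∀ {r} (T : Tree r) {i j} → (i , j) ∈ˡ segments T → i ∈ nodes T × j ∈ nodes T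
  segments⊆nodes (step {r} {w} _ T) (here eq) with r Fin.<? w | eq
  ... | yes _ | refl = p⊆p∪q (nodes T) (x∈⁅x⁆ r) , q⊆p∪q ⁅ r ⁆ (nodes T) (root∈nodes T)
  ... | no  _ | refl = q⊆p∪q ⁅ r ⁆ (nodes T) (root∈nodes T) , p⊆p∪q (nodes T) (x∈⁅x⁆ r)
  segments⊆nodes (step {r} _ T) (there e∈) =
    let p , q = segments⊆nodes T e∈ in q⊆p∪q ⁅ r ⁆ (nodes T) p , q⊆p∪q ⁅ r ⁆ (nodes T) q
  segments⊆nodes (join T U) e∈ with ∈-++⁻ (segments T) e∈
  ... | inj₁ e∈T = let p , q = segments⊆nodes T e∈T in p⊆p∪q (nodes U) p , p⊆p∪q (nodes U) q
  ... | inj₂ e∈U = let p , q = segments⊆nodes U e∈U in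
    q⊆p∪q (nodes T) (nodes U) p , q⊆p∪q (nodes T) (nodes U) q

  Linked : List (Fin n × Fin n) → Fin n → Fin n → Set
  Linked es i j = orient i j ∈ˡ es

  linked-sym : ∀ {es i j} → Linked es i j → Linked es j i
  linked-sym {es} {i} {j} = subst (_∈ˡ es) (orient-comm i j)

  fromRoot : ∀ {r x} (T : Tree r) → x ∈ nodes T → Star (Linked (segments T)) r x
  fromRoot (leaf r) x∈ with refl ← x∈⁅y⁆⇒x≡y r x∈ = ε
  fromRoot (step {r} _ T) x∈ with x∈p∪q⁻ ⁅ r ⁆ (nodes T) x∈
  ... | inj₁ x∈r with refl ← x∈⁅y⁆⇒x≡y r x∈r = ε
  ... | inj₂ x∈T = here refl ◅ Star.map there (fromRoot T x∈T)
  fromRoot (join T U) x∈ with x∈p∪q⁻ (nodes T) (nodes U) x∈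
  ... | inj₁ x∈T = Star.map ∈-++⁺ˡ (fromRoot T x∈T)
  ... | inj₂ x∈U = Star.map (∈-++⁺ʳ (segments T)) (fromRoot U x∈U)

  -- The image of `T` is the required subgraph. Each of its edges occurs among the segments, but a
  -- segment may occur twice, whence an inequality for `m`.
  tree⇒connectingSize : ∀ {r S} (T : Tree r) → S ⊆ nodes T → ∃ λ m → ConnectingSize G S m × m ≤ ∥ T ∥
  tree⇒connectingSize {r} T S⊆T = _ , (H , connected , S⊆T , refl) ,
    ≤-trans (unique-⊆⇒length≤ edges-unique edge⇒segment) (≤-reflexive (length-segments T))
    where
    open DecMembership (≡-dec Fin._≟_ Fin._≟_) using () renaming (_∈?_ to _∈ˡ?_)

    linked? : Fin n → Fin n → Bool
    linked? i j = isYes (orient i j ∈ˡ? segments T)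

    linked⇒edge : ∀ {i j} → Linked (segments T) i j → i ~ j
    linked⇒edge {i} {j} e∈ with i Fin.<? j
    ... | yes _ = segments⇒edge T e∈
    ... | no  _ = symmetric (segments⇒edge T e∈)

    linked⇒node : ∀ {i j} → Linked (segments T) i j → i ∈ nodes T
    linked⇒node {i} {j} e∈ with i Fin.<? j
    ... | yes _ = proj₁ (segments⊆nodes T e∈)
    ... | no  _ = proj₂ (segments⊆nodes T e∈)

    H : Subgraph G
    H = record
      { vertices = nodes T
      ; graph = record
        { adjacent = linked?
        ; symmetric = λ {i} {j} e → fromWitness (linked-sym {i = i} {j} (toWitness e))
        ; irreflexive = λ i≡j e → irreflexive i≡j (linked⇒edge (toWitness e)) }
      ; edge⇒edge = λ e → linked⇒edge (toWitness e)
      ; edge⇒vertex = λ {i} {j} e → linked⇒node {i} {j} (toWitness e) }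

    connected : ConnectedSubgraph H
    connected i∈ j∈ = Star.map fromWitness
      (Star.reverse (λ {i} {j} → linked-sym {i = i} {j}) (fromRoot T i∈) ◅◅ fromRoot T j∈)

    edge⇒segment : ∀ {e} → e ∈ˡ edges linked? → e ∈ˡ segments T
    edge⇒segment e∈ with i<j , e ← ∈-edges⁻ e∈ = subst (_∈ˡ segments T) (orient-< i<j) (toWitness e)

  -- From connected subgraphs to rooted trees.

  exit : ∀ {R : Fin n → Fin n → Set} (p : Subset n) {x y} → Star R x y → x ∈ p → y ∉ p →
         ∃₂ λ i j → R i j × i ∈ p × j ∉ p
  exit p ε x∈p y∉p = contradiction x∈p y∉p
  exit p (_◅_ {j = w} x~w s) x∈p y∉p with w ∈? p
  ... | yes w∈p = exit p s w∈p y∉p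
  ... | no  w∉p = -, -, x~w , x∈p , w∉p

  module _ (H : Subgraph G) (connected : ConnectedSubgraph H) where

    -- The used edges are collected in a separate list, because extending a
    -- tree inserts its new segment at an arbitrary position.
    record Injected {r} (T : Tree r) : Set where
      field
        used      : List (Fin n × Fin n)
        unique    : Unique used
        inGraph   : ∀ {e} → e ∈ˡ used → e ∈ˡ edges (Graph.adjacent (graph H))
        count     : length used ≡ ∥ T ∥
        endpoints : ∀ {i j} → (i , j) ∈ˡ used → i ∈ nodes T × j ∈ nodes T

    open Injected

    injected⇒∥∥≤size : ∀ {r} {T : Tree r} → Injected T → ∥ T ∥ ≤ size (graph H)
    injected⇒∥∥≤size I = ≤-trans (≤-reflexive (sym (count I))) (unique-⊆⇒length≤ (unique I) (inGraph I))

    extendInjected : ∀ {r x y} {T : Tree r} → Injected T → x ∈ nodes T → y ∉ nodes T →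
                     Subgraph._~_ H x y → ∃ λ (T′ : Tree r) → Injected T′ × ∥ T′ ∥ ≡ suc ∥ T ∥
    extendInjected {r} {x} {y} {T} I x∈T y∉T x~y = T′ , I′ , size′
      where
      ext : Extension T y 1
      ext = extend T x∈T (Subgraph.edge⇒edge H x~y)
      T′ = proj₁ ext
      size′ = proj₁ (proj₂ ext)
      T⊆T′ : nodes T ⊆ nodes T′
      T⊆T′ = proj₁ (proj₂ (proj₂ ext))
      y∈T′ = proj₂ (proj₂ (proj₂ ext))

      -- Both ends of a used edge are nodes of `T`, and `y` is not one.
      fresh : orient x y ∉ˡ used I
      fresh e∈ with x Fin.<? y
      ... | yes _ = y∉T (proj₂ (endpoints I e∈))
      ... | no  _ = y∉T (proj₁ (endpoints I e∈))

      I′ : Injected T′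
      I′ .used = orient x y ∷ used I
      I′ .unique = ¬Any⇒All¬ (used I) fresh ∷ unique I
      I′ .inGraph (here refl) = orient∈edges (graph H) x~y
      I′ .inGraph (there e∈)  = inGraph I e∈
      I′ .count = trans (cong suc (count I)) (sym size′)
      I′ .endpoints (here eq) with x Fin.<? y | eq
      ... | yes _ | refl = T⊆T′ x∈T , y∈T′
      ... | no  _ | refl = y∈T′ , T⊆T′ x∈T
      I′ .endpoints (there e∈) = let p , q = endpoints I e∈ in T⊆T′ p , T⊆T′ q

    -- While a vertex of `H` is missed, connectedness supplies an edge leaving the nodes of the
    -- tree. Adding it lowers the fuel by one and raises `∥ T ∥` by one, so the strict inequality
    -- persists. It fails at fuel zero, since the used edges are distinct edges of `H`.
    grow : ∀ fuel {r} (T : Tree r) → r ∈ vertices H → Injected T → size (graph H) < fuel + ∥ T ∥ →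
           ∃ λ (T′ : Tree r) → vertices H ⊆ nodes T′ × ∥ T′ ∥ ≤ size (graph H)
    grow zero T _ I h = contradiction (injected⇒∥∥≤size I) (<⇒≱ h)
    grow (suc fuel) {r} T r∈H I h with any? (λ x → (x ∈? vertices H) ×-dec ¬? (x ∈? nodes T))
    ... | no none = T , covered , injected⇒∥∥≤size I
      where
      covered : vertices H ⊆ nodes T
      covered {x} x∈H with x ∈? nodes T
      ... | yes x∈T = x∈T
      ... | no  x∉T = contradiction (x , x∈H , x∉T) none
    ... | yes (x , x∈H , x∉T) =
      let i , j , i~j , i∈T , j∉T = exit (nodes T) (connected r∈H x∈H) (root∈nodes T) x∉T
          T′ , I′ , size′ = extendInjected I i∈T j∉T i~j
      in grow fuel T′ r∈H I′
           (≤-trans h (≤-reflexive (trans (sym (+-suc fuel ∥ T ∥)) (cong (_+_ fuel) (sym size′)))))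

    spanningTree : ∀ {r} → r ∈ vertices H →
                   ∃ λ (T : Tree r) → vertices H ⊆ nodes T × ∥ T ∥ ≤ size (graph H)
    spanningTree {r} r∈H = grow (suc (size (graph H))) (leaf r) r∈H start (s≤s (m≤m+n _ _))
      where
      start : Injected (leaf r)
      start = record { used = [] ; unique = [] ; inGraph = λ () ; count = refl ; endpoints = λ () }

  -- Terminals, closed traversals and the first branching.

  -- The root of a step is not a terminal: only a leaf or a join can be responsible for
  -- covering a given vertex, and a tree splits a set of terminals only at joins.
  terminals : ∀ {r} → Tree r → Subset n
  terminals (leaf r)   = ⁅ r ⁆
  terminals (step _ T) = terminals T
  terminals (join T U) = terminals T ∪ terminals U

  terminals⊆nodes : ∀ {r} (T : Tree r) → terminals T ⊆ nodes T
  terminals⊆nodes (leaf r)       x∈ = x∈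
  terminals⊆nodes (step {r} _ T) x∈ = q⊆p∪q ⁅ r ⁆ (nodes T) (terminals⊆nodes T x∈)
  terminals⊆nodes (join T U)     x∈ with x∈p∪q⁻ (terminals T) (terminals U) x∈
  ... | inj₁ x∈T = p⊆p∪q (nodes U) (terminals⊆nodes T x∈T)
  ... | inj₂ x∈U = q⊆p∪q (nodes T) (nodes U) (terminals⊆nodes U x∈U)

  -- Joining a leaf at the root of every step makes that root a terminal at no cost in edges.
  -- Steiner trees cover a set by nodes, whereas the traversal arguments need it covered by
  -- terminals.
  saturate : ∀ {r} (T : Tree r) → ∃ λ (T′ : Tree r) → ∥ T′ ∥ ≡ ∥ T ∥ × nodes T ⊆ terminals T′
  saturate (leaf r)         = leaf r , refl , id
  saturate (step {r} r~w T) = let T′ , size , T⊆T′ = saturate T in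
    join (leaf r) (step r~w T′) , cong suc size , ∪-monoʳ ⁅ r ⁆ T⊆T′
  saturate (join T U) =
    let T′ , sizeT , T⊆T′ = saturate T
        U′ , sizeU , U⊆U′ = saturate U
    in join T′ U′ , cong₂ _+_ sizeT sizeU ,
       ∪-monoʳ (terminals T′) U⊆U′ ∘ ∪-monoˡ (nodes U) T⊆T′

  open Nat using (_*_)

  -- `p` and `q` may overlap, so the last case cuts `S` by `p` and its complement: the two parts are
  -- then disjoint and their cardinalities add up.
  data Split (S p q : Subset n) : Set where
    within₁ : S ⊆ p → Split S p q
    within₂ : S ⊆ q → Split S p q
    between : Nonempty (S ∩ p) → Nonempty (S ∩ ∁ p) → S ∩ ∁ p ⊆ q → Split S p q

  split : ∀ S p q → S ⊆ p ∪ q → Split S p q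
  split S p q S⊆ with nonempty? (S ∩ p) | nonempty? (S ∩ ∁ p)
  ... | yes ne₁ | yes ne₂ = between ne₁ ne₂ in₂
    where
    in₂ : S ∩ ∁ p ⊆ q
    in₂ x∈ with x∈S , x∈∁p ← x∈p∩q⁻ S (∁ p) x∈ with x∈p∪q⁻ p q (S⊆ x∈S)
    ... | inj₁ x∈p = contradiction x∈p (x∈∁p⇒x∉p x∈∁p)
    ... | inj₂ x∈q = x∈q
  ... | yes _ | no empty₂ = within₁ in₁
    where
    in₁ : S ⊆ p
    in₁ {x} x∈S with x ∈? p
    ... | yes x∈p = x∈p
    ... | no  x∉p = contradiction (x , x∈p∩q⁺ (x∈S , x∉p⇒x∈∁p x∉p)) empty₂
  ... | no empty₁ | _ = within₂ in₂
    where
    in₂ : S ⊆ q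
    in₂ {x} x∈S with x∈p∪q⁻ p q (S⊆ x∈S)
    ... | inj₁ x∈p = contradiction (x , x∈p∩q⁺ (x∈S , x∈p)) empty₁
    ... | inj₂ x∈q = x∈q

  Separated : ℕ → Subset n → Set
  Separated a S = ∀ {x y l} → x ∈ S → y ∈ S → x ≢ y → Walk l x y → a ≤ l

  -- A closed traversal of T from r visits S in gaps of length at least a,
  -- except for the first and the last, which have length at least the
  -- distance l to the nearest vertex of S.
  Reaches : ∀ {r} → Tree r → ℕ → Subset n → Set
  Reaches {r} T a S = ∃₂ λ u l → u ∈ S × Walk l r u × 2 * l + ∣ S ∣ * a ≤ 2 * ∥ T ∥ + a

  -- The sum of the two bounds has one `a` too many on the right. The farther side pays for it:
  -- `a ≤ l₁ + l₂ ≤ 2 * l₂`. In the traversal this is the new gap between the two parts.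
  nearer : ∀ l₁ l₂ c₁ c₂ t₁ t₂ a → a ≤ l₁ + l₂ → l₁ ≤ l₂ →
           2 * l₁ + c₁ * a ≤ 2 * t₁ + a → 2 * l₂ + c₂ * a ≤ 2 * t₂ + a →
           2 * l₁ + (c₁ + c₂) * a ≤ 2 * (t₁ + t₂) + a
  nearer l₁ l₂ c₁ c₂ t₁ t₂ a a≤ l₁≤l₂ h₁ h₂ = +-cancelʳ-≤ a _ _ (begin
    2 * l₁ + (c₁ + c₂) * a + a            ≤⟨ +-monoʳ-≤ _ (≤-trans a≤ (+-monoˡ-≤ l₂ l₁≤l₂)) ⟩
    2 * l₁ + (c₁ + c₂) * a + (l₂ + l₂)    ≡⟨ lhs l₁ l₂ c₁ c₂ a ⟩
    (2 * l₁ + c₁ * a) + (2 * l₂ + c₂ * a) ≤⟨ +-mono-≤ h₁ h₂ ⟩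
    (2 * t₁ + a) + (2 * t₂ + a)           ≡⟨ rhs t₁ t₂ a ⟩
    2 * (t₁ + t₂) + a + a                 ∎)
    where
    open ≤-Reasoning
    lhs : ∀ l₁ l₂ c₁ c₂ a → 2 * l₁ + (c₁ + c₂) * a + (l₂ + l₂) ≡ (2 * l₁ + c₁ * a) + (2 * l₂ + c₂ * a)
    lhs = solve-∀
    rhs : ∀ t₁ t₂ a → (2 * t₁ + a) + (2 * t₂ + a) ≡ 2 * (t₁ + t₂) + a + a
    rhs = solve-∀

  separated-⊆ : ∀ {a S S′} → S′ ⊆ S → Separated a S → Separated a S′
  separated-⊆ S′⊆S sep x∈ y∈ = sep (S′⊆S x∈) (S′⊆S y∈)

  reaches-mono : ∀ {r a S} (T U : Tree r) → ∥ T ∥ ≤ ∥ U ∥ → Reaches T a S → Reaches U a S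
  reaches-mono {a = a} T U T≤U (u , l , u∈S , p , h) =
    u , l , u∈S , p , ≤-trans h (+-monoˡ-≤ a (*-monoʳ-≤ 2 T≤U))

  -- Induction on `T`. At a leaf `S` is a single vertex; a step is traversed twice and lengthens the
  -- first and last pieces by one each; at a join that divides `S` the two traversals are
  -- concatenated and the nearer vertex is kept.
  reaches : ∀ {r a} (T : Tree r) S → S ⊆ terminals T → Nonempty S → Separated a S → Reaches T a S
  reaches {a = a} (leaf r) S S⊆ (u , u∈S) _ with refl ← x∈⁅y⁆⇒x≡y r (S⊆ u∈S) =
    r , 0 , u∈S , refl , ≤-trans (*-monoˡ-≤ a ∣S∣≤1) (≤-reflexive (*-identityˡ a))
    where
    ∣S∣≤1 : ∣ S ∣ ≤ 1
    ∣S∣≤1 = ≤-trans (p⊆q⇒∣p∣≤∣q∣ S⊆) (≤-reflexive (∣⁅x⁆∣≡1 r))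
  reaches {a = a} (step r~w T) S S⊆ ne sep =
    let u , l , u∈S , p , h = reaches T S S⊆ ne sep in
    u , suc l , u∈S , (-, r~w , p) ,
    subst₂ _≤_ (shift l (∣ S ∣ * a)) (shift ∥ T ∥ a) (+-monoʳ-≤ 2 h)
    where
    shift : ∀ m b → 2 + (2 * m + b) ≡ 2 * suc m + b
    shift = solve-∀
  reaches {a = a} (join T U) S S⊆ ne sep with split S (terminals T) (terminals U) S⊆
  ... | within₁ S⊆T = reaches-mono T (join T U) (m≤m+n _ _) (reaches T S S⊆T ne sep)
  ... | within₂ S⊆U = reaches-mono U (join T U) (m≤n+m _ _) (reaches U S S⊆U ne sep)
  ... | between ne₁ ne₂ ⊆U
    with u₁ , l₁ , u₁∈ , p₁ , h₁ ← reaches T (S ∩ terminals T) (p∩q⊆q S _) ne₁ (separated-⊆ (p∩q⊆p S _) sep)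
       | u₂ , l₂ , u₂∈ , p₂ , h₂ ← reaches U (S ∩ ∁ (terminals T)) ⊆U ne₂ (separated-⊆ (p∩q⊆p S _) sep)
    with u₁∈S , u₁∈T ← x∈p∩q⁻ S (terminals T) u₁∈
       | u₂∈S , u₂∈∁T ← x∈p∩q⁻ S (∁ (terminals T)) u₂∈
    -- The two vertices differ because only `u₁` is a terminal of `T`; the walk between them passes
    -- through the common root.
    with a≤ ← sep u₁∈S u₂∈S (λ { refl → x∈∁p⇒x∉p u₂∈∁T u₁∈T }) (walk-++ l₁ (walk-reverse l₁ p₁) p₂)
    with eq ← ∣p∩q∣+∣p∩∁q∣≡∣p∣ S (terminals T)
    with ≤-total l₁ l₂
  ... | inj₁ l₁≤l₂ = u₁ , l₁ , u₁∈S , p₁ ,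
    subst (λ m → 2 * l₁ + m * a ≤ 2 * (∥ T ∥ + ∥ U ∥) + a) eq
      (nearer l₁ l₂ ∣ S ∩ terminals T ∣ _ ∥ T ∥ ∥ U ∥ a a≤ l₁≤l₂ h₁ h₂)
  ... | inj₂ l₂≤l₁ = u₂ , l₂ , u₂∈S , p₂ ,
    subst₂ (λ m t → 2 * l₂ + m * a ≤ 2 * t + a)
      (trans (+-comm ∣ S ∩ ∁ (terminals T) ∣ _) eq) (+-comm ∥ U ∥ ∥ T ∥)
      (nearer l₂ l₁ ∣ S ∩ ∁ (terminals T) ∣ _ ∥ U ∥ ∥ T ∥ a
        (≤-trans a≤ (≤-reflexive (+-comm l₁ l₂))) l₂≤l₁ h₂ h₁)

  -- Here `q` ends the stem and `p` is its length. The traversals of the two parts are added without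
  -- being merged at `q`, hence `2 * a` on the right: both `l₁` and `l₂` survive, and each is later
  -- bounded below by a walk along the stem.
  record Branching (r : Fin n) (size a : ℕ) (S : Subset n) : Set where
    field
      {q}         : Fin n
      {p l₁ l₂}   : ℕ
      {u₁ u₂}     : Fin n
      toBranch    : Walk p r q
      subtree     : Tree q
      S⊆subtree   : S ⊆ nodes subtree
      subtree≤    : p + ∥ subtree ∥ ≤ size
      u₁∈S        : u₁ ∈ S
      u₂∈S        : u₂ ∈ S
      walk₁       : Walk l₁ q u₁
      walk₂       : Walk l₂ q u₂
      traversal   : 2 * l₁ + 2 * l₂ + ∣ S ∣ * a ≤ 2 * ∥ subtree ∥ + 2 * a

  branching-mono : ∀ {r s s′ a S} → s ≤ s′ → Branching r s a S → Branching r s′ a S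
  branching-mono s≤s′ B = record { Branching B ; subtree≤ = ≤-trans (Branching.subtree≤ B) s≤s′ }

  -- Descend from the root: a step lengthens the stem, a join with `S` on one side discards the
  -- other side, and the first join that divides `S` is the branching. A leaf cannot be reached, as
  -- it has only one terminal.
  branching : ∀ {r a} (T : Tree r) S → S ⊆ terminals T → 2 ≤ ∣ S ∣ → Separated a S →
              Branching r ∥ T ∥ a S
  branching (leaf r) S S⊆ 2≤∣S∣ _ =
    contradiction (≤-trans 2≤∣S∣ (≤-trans (p⊆q⇒∣p∣≤∣q∣ S⊆) (≤-reflexive (∣⁅x⁆∣≡1 r)))) λ { (s≤s ()) }
  branching (step r~w T) S S⊆ 2≤∣S∣ sep = let B = branching T S S⊆ 2≤∣S∣ sep in
    record { Branching B ; p = suc (Branching.p B) ; toBranch = -, r~w , Branching.toBranch B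
           ; subtree≤ = s≤s (Branching.subtree≤ B) }
  branching {a = a} (join T U) S S⊆ 2≤∣S∣ sep with split S (terminals T) (terminals U) S⊆
  ... | within₁ S⊆T = branching-mono (m≤m+n _ _) (branching T S S⊆T 2≤∣S∣ sep)
  ... | within₂ S⊆U = branching-mono (m≤n+m _ _) (branching U S S⊆U 2≤∣S∣ sep)
  ... | between ne₁ ne₂ ⊆U =
    let u₁ , l₁ , u₁∈ , p₁ , h₁ = reaches T (S ∩ terminals T) (p∩q⊆q S _) ne₁
                                    (separated-⊆ (p∩q⊆p S _) sep)
        u₂ , l₂ , u₂∈ , p₂ , h₂ = reaches U (S ∩ ∁ (terminals T)) ⊆U ne₂
                                    (separated-⊆ (p∩q⊆p S _) sep)
    in record
      { toBranch = refl ; subtree = join T U ; S⊆subtree = terminals⊆nodes (join T U) ∘ S⊆ ; subtree≤ = ≤-refl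
      ; u₁∈S = p∩q⊆p S _ u₁∈ ; u₂∈S = p∩q⊆p S _ u₂∈ ; walk₁ = p₁ ; walk₂ = p₂
      ; traversal = subst (λ m → 2 * l₁ + 2 * l₂ + m * a ≤ 2 * (∥ T ∥ + ∥ U ∥) + 2 * a)
          (∣p∩q∣+∣p∩∁q∣≡∣p∣ S (terminals T))
          (subst₂ _≤_ (lhs l₁ l₂ ∣ S ∩ terminals T ∣ ∣ S ∩ ∁ (terminals T) ∣ a) (rhs ∥ T ∥ ∥ U ∥ a)
            (+-mono-≤ h₁ h₂)) }
    where
    lhs : ∀ l₁ l₂ c₁ c₂ a → (2 * l₁ + c₁ * a) + (2 * l₂ + c₂ * a) ≡ 2 * l₁ + 2 * l₂ + (c₁ + c₂) * a
    lhs = solve-∀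
    rhs : ∀ t₁ t₂ a → (2 * t₁ + a) + (2 * t₂ + a) ≡ 2 * (t₁ + t₂) + 2 * a
    rhs = solve-∀

  -- The numerical estimate.

  excess-bound : ∀ c R x a p t l₁ l₂ → x ≤ p + l₁ → x ≤ p + l₂ → x ≤ a →
                 R + x ≤ a + t → p + t ≤ R →
                 2 * l₁ + 2 * l₂ + (4 + c) * a ≤ 2 * t + 2 * a →
                 (6 + c) * (R + x) ≤ (8 + c) * R
  excess-bound c R x a p t l₁ l₂ x≤₁ x≤₂ x≤a D≤ p+t≤R h =
    -- With `c = k - 5` the core is `(k + 1) * x ≤ 2 * R`, to which `(k + 1) * R` is added.
    -- Truncated subtraction is avoided by adding to both sides `z`, the terms other than `x` and
    -- `R` in the weighted sum of the hypotheses.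
    subst₂ _≤_ (lhs c R x) (rhs c R) (+-monoʳ-≤ ((6 + c) * R) (+-cancelʳ-≤ z _ _ (begin
      (6 + c) * x + z
        ≡⟨ sum₁ c x a p t l₁ l₂ ⟩
      2 * x + 2 * x + 2 * (p + x) + c * x + 2 * (p + t) + (2 * l₁ + 2 * l₂ + (4 + c) * a)
        ≤⟨ +-mono-≤ (+-mono-≤ (+-mono-≤ (+-mono-≤ (+-mono-≤ (*-monoʳ-≤ 2 x≤₁) (*-monoʳ-≤ 2 x≤₂))
             (*-monoʳ-≤ 2 p+x≤a)) (*-monoʳ-≤ c x≤a)) (*-monoʳ-≤ 2 p+t≤R)) h ⟩
      2 * (p + l₁) + 2 * (p + l₂) + 2 * a + c * a + 2 * R + (2 * t + 2 * a)
        ≡⟨ sum₂ c R a p t l₁ l₂ ⟩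
      2 * R + z ∎)))
    where
    open ≤-Reasoning
    z : ℕ
    z = 4 * p + 2 * t + 2 * l₁ + 2 * l₂ + (4 + c) * a
    shuffle : ∀ p x t → (p + x) + t ≡ (p + t) + x
    shuffle = solve-∀
    p+x≤a : p + x ≤ a
    p+x≤a = +-cancelʳ-≤ t _ _ (≤-trans (≤-reflexive (shuffle p x t)) (≤-trans (+-monoˡ-≤ x p+t≤R) D≤))
    lhs : ∀ c R x → (6 + c) * R + (6 + c) * x ≡ (6 + c) * (R + x)
    lhs = solve-∀
    rhs : ∀ c R → (6 + c) * R + 2 * R ≡ (8 + c) * R
    rhs = solve-∀
    sum₁ : ∀ c x a p t l₁ l₂ →
           (6 + c) * x + (4 * p + 2 * t + 2 * l₁ + 2 * l₂ + (4 + c) * a) ≡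
           2 * x + 2 * x + 2 * (p + x) + c * x + 2 * (p + t) + (2 * l₁ + 2 * l₂ + (4 + c) * a)
    sum₁ = solve-∀
    sum₂ : ∀ c R a p t l₁ l₂ →
           2 * (p + l₁) + 2 * (p + l₂) + 2 * a + c * a + 2 * R + (2 * t + 2 * a) ≡
           2 * R + (4 * p + 2 * t + 2 * l₁ + 2 * l₂ + (4 + c) * a)
    sum₂ = solve-∀

  -- Bounds on Steiner distances.

  module _ (conn : Connected G) where

    private
      d : Subset n → ℕ
      d = steinerDistance G conn

    d≤∥∥ : ∀ {r S} (T : Tree r) → S ⊆ nodes T → d S ≤ ∥ T ∥
    d≤∥∥ {S = S} T S⊆T = let m , c , m≤ = tree⇒connectingSize T S⊆T in
      ≤-trans (proj₂ (steinerDistance-isLeast G conn S) c) m≤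

    steinerTree : ∀ {v S} → v ∈ S → ∃ λ (T : Tree v) → S ⊆ nodes T × ∥ T ∥ ≤ d S
    steinerTree {v} {S} v∈S =
      let (H , connected , S⊆H , eq) , _ = steinerDistance-isLeast G conn S
          T , H⊆T , ∥T∥≤ = spanningTree H connected (S⊆H v∈S)
      in T , H⊆T ∘ S⊆H , ≤-trans ∥T∥≤ (≤-reflexive eq)

    -- Attaching `y` to `T` along the walk covers all of `S`. This serves both for a Steiner tree
    -- through `v` and for the subtree left after the stem is dropped.
    d≤l+∥∥ : ∀ {l r x y S} (T : Tree r) → S - y ⊆ nodes T → x ∈ nodes T → Walk l x y → d S ≤ l + ∥ T ∥
    d≤l+∥∥ {l} {y = y} {S} T S-y⊆T x∈T p =
      let T′ , size , T⊆T′ , y∈T′ = extendByWalk l T x∈T p in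
      ≤-trans (d≤∥∥ T′ (covered T⊆T′ y∈T′)) (≤-reflexive size)
      where
      covered : ∀ {p} → nodes T ⊆ p → y ∈ p → S ⊆ p
      covered T⊆p y∈p {z} z∈S with z Fin.≟ y
      ... | yes refl = y∈p
      ... | no  z≢y  = T⊆p (S-y⊆T (x∈p∧x≢y⇒x∈p-y z∈S z≢y))

    closestPair : ∀ {S} → 2 ≤ ∣ S ∣ →
      ∃ λ a → Separated a S × ∃₂ λ x y → x ∈ S × y ∈ S × x ≢ y × Walk a x y
    closestPair {S} 2≤∣S∣ =
      let x , x∈S = nonempty (≤-trans (s≤s z≤n) 2≤∣S∣)
          y , y∈S-x = nonempty (s≤s⁻¹ (≤-trans 2≤∣S∣ (≤-reflexive (sym (x∈p⇒suc∣p-x∣≡∣p∣ x∈S)))))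
          l , p = star⇒walk (conn x y)
          a , (x′ , y′ , closest) , minimal =
            least (λ l → any? λ x → any? λ y →
                     (x ∈? S) ×-dec (y ∈? S) ×-dec ¬? (x Fin.≟ y) ×-dec walk? l x y)
              (l , x , y , x∈S , p─q⊆p S _ y∈S-x , ≢-sym (x∈p-y⇒x≢y S y∈S-x) , p)
      in a , (λ x∈S y∈S x≢y p → minimal (-, -, x∈S , y∈S , x≢y , p)) , x′ , y′ , closest

    module _ {k R : ℕ} {v : Fin n} (5≤k : 5 ≤ k)
             (bound : ∀ S → ∣ S ∣ ≡ k → v ∈ S → d S ≤ R) where

      -- Exchanging `s` for `v` keeps the cardinality `k` because `v ∉ S`, so `bound` applies to the
      -- new set.
      replacingTree : ∀ {S s} → v ∉ S → ∣ S ∣ ≡ k → s ∈ S →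
                      ∃ λ (T : Tree v) → S - s ⊆ nodes T × ∥ T ∥ ≤ R
      replacingTree {S} {s} v∉S ∣S∣≡k s∈S =
        let T , ⊆T , ∥T∥≤ = steinerTree (q⊆p∪q (S - s) ⁅ v ⁆ (x∈⁅x⁆ v))
        in T , ⊆T ∘ p⊆p∪q ⁅ v ⁆ , ≤-trans ∥T∥≤ (bound _ ∣S-s∪v∣≡k (q⊆p∪q (S - s) ⁅ v ⁆ (x∈⁅x⁆ v)))
        where
        ∣S-s∪v∣≡k : ∣ (S - s) ∪ ⁅ v ⁆ ∣ ≡ k
        ∣S-s∪v∣≡k = trans (x∉p⇒∣p∪⁅x⁆∣≡suc∣p∣ (S - s) (v∉S ∘ p─q⊆p S _)) (trans (x∈p⇒suc∣p-x∣≡∣p∣ s∈S) ∣S∣≡k)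

      -- When `d S` is `R` plus an excess, every such walk is at least as long as the excess. The
      -- two cases for `x` are walks from `v` to `S` and walks between distinct vertices of `S`.
      d≤l+R : ∀ {l x s S} → v ∉ S → ∣ S ∣ ≡ k → s ∈ S → x ≡ v ⊎ x ∈ S - s → Walk l x s → d S ≤ l + R
      d≤l+R {l} {x} {s} v∉S ∣S∣≡k s∈S x∈ p = let T , ⊆T , ∥T∥≤R = replacingTree v∉S ∣S∣≡k s∈S in
        ≤-trans (d≤l+∥∥ T ⊆T ([ (λ { refl → root∈nodes T }) , ⊆T ]′ x∈) p) (+-monoʳ-≤ l ∥T∥≤R)

      v∉S⇒d-bound : ∀ c {S x} → k ≡ 5 + c → v ∉ S → ∣ S ∣ ≡ k → d S ≡ R + x →
                    (6 + c) * (R + x) ≤ (8 + c) * R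
      v∉S⇒d-bound c {S} {x} refl v∉S ∣S∣≡k d≡
        with a , sep , y , s , y∈S , s∈S , y≢s , near
          ← closestPair (subst (2 ≤_) (sym ∣S∣≡k) (s≤s (s≤s z≤n)))
        with T , ⊆T , ∥T∥≤R ← replacingTree v∉S ∣S∣≡k s∈S
        with T′ , size , T⊆T′ ← saturate T
        with ∣S-s∣≡4+c ← suc-injective (trans (x∈p⇒suc∣p-x∣≡∣p∣ s∈S) ∣S∣≡k)
           | y∈S-s ← x∈p∧x≢y⇒x∈p-y y∈S y≢s
        with record { p = p ; l₁ = l₁ ; l₂ = l₂ ; toBranch = toBranch ; subtree = T₀ ; S⊆subtree = ⊆T₀
                    ; subtree≤ = p+T₀≤ ; u₁∈S = u₁∈S ; u₂∈S = u₂∈S ; walk₁ = walk₁ ; walk₂ = walk₂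
                    ; traversal = traversal }
          ← branching T′ (S - s) (T⊆T′ ∘ ⊆T) (subst (2 ≤_) (sym ∣S-s∣≡4+c) (s≤s (s≤s z≤n)))
              (separated-⊆ (p─q⊆p S _) sep)
        = excess-bound c R x a p ∥ T₀ ∥ l₁ l₂
            -- The stem followed by the walk from its end to `u₁` leads from `v` into `S`.
            (excess≤ (d≤l+R v∉S ∣S∣≡k (p─q⊆p S _ u₁∈S) (inj₁ refl) (walk-++ p toBranch walk₁)))
            (excess≤ (d≤l+R v∉S ∣S∣≡k (p─q⊆p S _ u₂∈S) (inj₁ refl) (walk-++ p toBranch walk₂)))
            (excess≤ (d≤l+R v∉S ∣S∣≡k s∈S (inj₂ y∈S-s) near))
            -- `T₀` lacks the stem but still contains `S - s`, in particular `y`; so `s` can be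
            -- attached at cost `a`.
            (subst (_≤ a + ∥ T₀ ∥) d≡ (d≤l+∥∥ T₀ ⊆T₀ (⊆T₀ y∈S-s) near))
            (≤-trans p+T₀≤ (≤-trans (≤-reflexive size) ∥T∥≤R))
            (subst (λ m → 2 * l₁ + 2 * l₂ + m * a ≤ 2 * ∥ T₀ ∥ + 2 * a) ∣S-s∣≡4+c traversal)
        where
        excess≤ : ∀ {l} → d S ≤ l + R → x ≤ l
        excess≤ {l} d≤ = +-cancelˡ-≤ R _ _
          (≤-trans (≤-reflexive (sym d≡)) (≤-trans d≤ (≤-reflexive (+-comm l R))))

      d-bound : ∀ S → ∣ S ∣ ≡ k → d S * (1 + k) ≤ (k + 3) * R
      d-bound S ∣S∣≡k with d S ≤? R
      -- Without excess, `1 + k ≤ k + 3` suffices.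
      ... | yes d≤R = ≤-trans (*-mono-≤ d≤R (≤-trans (m≤n+m _ 2) (≤-reflexive (+-comm 3 k))))
                        (≤-reflexive (*-comm R _))
      ... | no d≰R with v ∈? S
      ...   | yes v∈S = contradiction (bound S ∣S∣≡k v∈S) d≰R
      ...   | no v∉S = far (m≤n⇒∃[o]m+o≡n 5≤k) (m≤n⇒∃[o]m+o≡n (≰⇒≥ d≰R))
        where
        far : (∃ λ c → 5 + c ≡ k) → (∃ λ x → R + x ≡ d S) → d S * (1 + k) ≤ (k + 3) * R
        far (c , refl) (x , R+x≡d) = subst₂ _≤_
          (trans (*-comm (6 + c) (R + x)) (cong (_* (6 + c)) R+x≡d))
          (cong (_* R) (+-comm 3 (5 + c)))
          (v∉S⇒d-bound c {S} {x} refl v∉S ∣S∣≡k (sym R+x≡d))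

-- Passage to rational numbers.

open import Data.Rational as ℚ using (_/_; _*_) renaming (_≤_ to _≤ℚ_)

-- Cross-multiplication, carried out on unnormalised fractions because `_/_` reduces to lowest
-- terms.
/-≤-* : ∀ a b c d → a Nat.* suc c ≤ b Nat.* d → + a / 1 ≤ℚ (+ b / suc c) * (+ d / 1)
/-≤-* a b c d h = ℚ.toℚᵘ-cancel-≤ (begin
  ℚ.toℚᵘ (+ a / 1)                                 ≃⟨ ℚ.toℚᵘ-fromℚᵘ (ℚᵘ.mkℚᵘ (+ a) 0) ⟩
  ℚᵘ.mkℚᵘ (+ a) 0                                  ≤⟨ ℚᵘ.*≤* le ⟩
  ℚᵘ.mkℚᵘ (+ b) c ℚᵘ.* ℚᵘ.mkℚᵘ (+ d) 0             ≃⟨ ℚᵘ.*-cong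
                                                        (ℚ.toℚᵘ-fromℚᵘ (ℚᵘ.mkℚᵘ (+ b) c))
                                                        (ℚ.toℚᵘ-fromℚᵘ (ℚᵘ.mkℚᵘ (+ d) 0)) ⟨
  ℚ.toℚᵘ (+ b / suc c) ℚᵘ.* ℚ.toℚᵘ (+ d / 1)       ≃⟨ ℚ.toℚᵘ-homo-* (+ b / suc c) (+ d / 1) ⟨
  ℚ.toℚᵘ ((+ b / suc c) * (+ d / 1))               ∎)
  where
  open ℚᵘ.≤-Reasoning
  le : + a ℤ.* + (suc c Nat.* 1) ℤ.≤ (+ b ℤ.* + d) ℤ.* + 1
  le = subst₂ ℤ._≤_
    (trans (ℤ.pos-* a (suc c)) (cong (λ m → + a ℤ.* + m) (sym (*-identityʳ (suc c)))))
    (trans (ℤ.pos-* b d) (sym (ℤ.*-identityʳ (+ b ℤ.* + d))))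
    (ℤ.+≤+ h)

theorem3 : (k : ℕ) (5≤k : 5 ≤ k) (n : ℕ) (G : Graph n) (conn : Connected G) (k≤n : k ≤ n) →
    let 2≤k = ≤-trans (m≤m+n 2 3) 5≤k in
    + sdiam G conn k 2≤k k≤n / 1 ≤ℚ (+ (k + 3) / (1 + k)) * (+ srad G conn k 2≤k k≤n / 1)
theorem3 k 5≤k n G conn k≤n =
  let 2≤k = ≤-trans (m≤m+n 2 3) 5≤k
      (v , ecc-v≡srad) , _ = srad-isLeast G conn k 2≤k k≤n
      (w , ecc-w≡sdiam) , _ = sdiam-isGreatest G conn k 2≤k k≤n
      (S , ∣S∣≡k , _ , d≡ecc-w) , _ = eccentricity-isGreatest G conn k 2≤k k≤n w
      _ , d≤ecc-v = eccentricity-isGreatest G conn k 2≤k k≤n v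
      bound = λ S′ ∣S′∣≡k v∈S′ → ≤-trans (d≤ecc-v (S′ , ∣S′∣≡k , v∈S′ , refl)) (≤-reflexive ecc-v≡srad)
      R = srad G conn k 2≤k k≤n
  in /-≤-* (sdiam G conn k 2≤k k≤n) (k + 3) k R
       (subst (λ D → D Nat.* (1 + k) ≤ (k + 3) Nat.* R) (trans d≡ecc-w ecc-w≡sdiam)
         (d-bound G conn 5≤k bound S ∣S∣≡k))
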